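{- If $T$ is a tree of order $p\ge 3$, then $\gamma_{[3R]}(T)\le \frac{7p}{4}$.
   Context: For a graph $\Gamma=(V,E)$ and $h:V\to\{0,1,2,3,4\}$, let $AN(v)=\{w\in N(v):h(w)\ge 1\}$, $AN[v]=AN(v)\cup\{v\}$ and $h(S)=\sum_{u\in S}h(u)$. $h$ is a triple Roman dominating function (3RDF) if every $v$ with $h(v)<3$ satisfies $h(AN[v])\ge|AN(v)|+3$. The triple Roman domination number $\gamma_{[3R]}(\Gamma)$ is the minimum weight $h(V)$ of a 3RDF of $\Gamma$. -}

module Defs where

open import Level using (0ℓ)
open import Data.Nat.Base using (ℕ; _+_; _≤_; _<_; _≥_; s≤s⁻¹)
open import Data.Nat.Properties using (_≟_; _<?_; _≥?_; ≮⇒≥; anyUpTo?; +-0-monoid)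
open import Data.Nat.Induction using (<-rec)
open import Data.Bool.Base using (if_then_else_)
open import Data.Fin.Base using (Fin; zero; suc; toℕ; inject₁; fromℕ; funToFin; finToFun)
open import Data.Fin.Properties using (any?; all?; finToFun-funToFin)
open import Data.Fin.Subset using (Subset; ∣_∣; ⊤; ⁅_⁆; _∪_)
open import Data.Vec.Base using (lookup; tabulate)
open import Data.Vec.Properties using (tabulate-cong)
open import Data.Product.Base using (∃; _×_; _,_; proj₁; proj₂)
open import Function.Base using (const)
open import Function.Definitions using (Injective)
open import Relation.Binary.Core using (Rel)
open import Relation.Binary.Definitions using (Symmetric; Decidable)
open import Relation.Binary.Construct.Closure.ReflexiveTransitive using (Star)
open import Relation.Binary.PropositionalEquality using (_≡_; _≗_; refl; sym; trans; cong; subst; subst₂)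
open import Relation.Nullary using (¬_; Dec; yes; no; does; contradiction)
open import Relation.Nullary.Decidable using (map′; _×-dec_; _→-dec_)
import Relation.Unary as U
open import Algebra.Properties.Monoid.Sum +-0-monoid using (sum; sum-cong-≗)

-- Finite simple graphs of order p, on the vertex set Fin p.
record Graph (p : ℕ) : Set₁ where
  infix 4 _~_ _~?_
  field
    _~_      : Rel (Fin p) 0ℓ
    _~?_     : Decidable _~_
    ~-sym    : Symmetric _~_
    ~-irrefl : ∀ v → ¬ v ~ v

module _ {p : ℕ} (Γ : Graph p) where
  open Graph Γ

  Connected : Set
  Connected = ∀ u v → Star _~_ u v

  -- A cycle of length 3 + k.
  record Cycle (k : ℕ) : Set where
    field
      vertex   : Fin (3 + k) → Fin p
      distinct : Injective _≡_ _≡_ vertex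
      step     : ∀ (i : Fin (2 + k)) → vertex (inject₁ i) ~ vertex (suc i)
      close    : vertex (fromℕ (2 + k)) ~ vertex zero

  Acyclic : Set
  Acyclic = ∀ k → ¬ Cycle k

  record IsTree : Set where
    field
      connected : Connected
      acyclic   : Acyclic

Labelling : ℕ → Set
Labelling p = Fin p → Fin 5

-- h ⟦ S ⟧ is h(S), the sum of h(u) over u ∈ S.
infix 8 _⟦_⟧
_⟦_⟧ : ∀ {p} → Labelling p → Subset p → ℕ
h ⟦ S ⟧ = sum (λ u → if lookup S u then toℕ (h u) else 0)

weight : ∀ {p} → Labelling p → ℕ
weight h = h ⟦ ⊤ ⟧

module _ {p : ℕ} (Γ : Graph p) where
  open Graph Γ

  AN : Labelling p → Fin p → Subset p
  AN h v = tabulate (λ w → does ((v ~? w) ×-dec (toℕ (h w) ≥? 1)))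

  AN[_,_] : Labelling p → Fin p → Subset p
  AN[ h , v ] = AN h v ∪ ⁅ v ⁆

  Is3RDF : Labelling p → Set
  Is3RDF h = ∀ v → toℕ (h v) < 3 → h ⟦ AN[ h , v ] ⟧ ≥ ∣ AN h v ∣ + 3

  record IsMin3RDFWeight (k : ℕ) : Set where
    field
      attained   : ∃ λ h → Is3RDF h × weight h ≡ k
      lowerBound : ∀ h → Is3RDF h → k ≤ weight h

  private
    ⟦⟧-cong : ∀ {h h′ : Labelling p} {S S′} → h ≗ h′ → S ≡ S′ → h ⟦ S ⟧ ≡ h′ ⟦ S′ ⟧
    ⟦⟧-cong {S = S} e refl =
      sum-cong-≗ (λ u → cong (λ x → if lookup S u then toℕ x else 0) (e u))

    AN-cong : ∀ {h h′} → h ≗ h′ → ∀ v → AN h v ≡ AN h′ v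
    AN-cong e v =
      tabulate-cong (λ w → cong (λ x → does ((v ~? w) ×-dec (toℕ x ≥? 1))) (e w))

    Is3RDF-resp : ∀ {h h′} → h ≗ h′ → Is3RDF h → Is3RDF h′
    Is3RDF-resp e d v h′v<3 =
      subst₂ _≥_ (⟦⟧-cong e (cong (_∪ ⁅ v ⁆) (AN-cong e v)))
        (cong (λ S → ∣ S ∣ + 3) (AN-cong e v))
        (d v (subst (λ x → toℕ x < 3) (sym (e v)) h′v<3))

    is3RDF? : U.Decidable Is3RDF
    is3RDF? h = all? (λ v → (toℕ (h v) <? 3) →-dec (_ ≥? _))

    Attained : ℕ → Set
    Attained k = ∃ λ h → Is3RDF h × weight h ≡ k

    attained? : U.Decidable Attained
    attained? k = map′
      (λ (i , q) → finToFun i , q)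
      (λ (h , d , w≡k) → let e = finToFun-funToFin h in
        funToFin h , Is3RDF-resp (λ v → sym (e v)) d , trans (⟦⟧-cong {S = ⊤} e refl) w≡k)
      (any? (λ i → is3RDF? (finToFun i) ×-dec (weight {p} (finToFun i) ≟ k)))

    least : ∀ n → Attained n → ∃ λ k → Attained k × (∀ j → Attained j → k ≤ j)
    least = <-rec _ λ n rec a → case-on n rec a (anyUpTo? attained? n)
      where
      Goal : Set
      Goal = ∃ λ k → Attained k × (∀ j → Attained j → k ≤ j)
      case-on : ∀ n → (∀ {m} → m < n → Attained m → Goal) → Attained n →
                Dec (∃ λ m → m < n × Attained m) → Goal
      case-on n rec a (yes (m , m<n , b)) = rec m<n b
      case-on n rec a (no ¬b) = n , a , λ j b → ≮⇒≥ (λ j<n → ¬b (j , j<n , b))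

    all-4 : Labelling p
    all-4 = const (fromℕ 4)

    all-4-is3RDF : Is3RDF all-4
    all-4-is3RDF v 4<3 = contradiction (s≤s⁻¹ (s≤s⁻¹ (s≤s⁻¹ 4<3))) λ ()

  min3RDFWeight : ∃ IsMin3RDFWeight
  min3RDFWeight with least _ (all-4 , all-4-is3RDF , refl)
  ... | k , a , lb = k , record
    { attained = a ; lowerBound = λ h d → lb _ (h , d , refl) }

  γ[3R] : ℕ
  γ[3R] = proj₁ min3RDFWeight

  γ[3R]-isMin : IsMin3RDFWeight γ[3R]
  γ[3R]-isMin = proj₂ min3RDFWeight

{-# OPTIONS --safe #-}
module Submission where

-- A labelling h satisfies the domination condition at v as soon as
-- h(v) + Σ_{w ~ v} (h(w) ∸ 1) ≥ 3. Adding edges only helps, so it is enough to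
-- label a spanning tree, grown vertex by vertex from a root. Give each vertex
-- one of five states, recording the excess it offers its neighbours and the
-- excess it still needs from them. A rooted tree is summarised by its cost
-- profile: an upper bound, for each state of the root, on the weight of a
-- labelling, measured against 7/4 per vertex. Five profiles are closed under
-- attaching one rooted tree to the root of another, and every profile of a tree
-- with at least three vertices admits a state without need at cost at most 7/4
-- per vertex. Contracting the leaves one at a time, in reverse order of growth,
-- reduces the spanning tree to its root and gives the bound.

open import Defs
open import Data.Nat.Base using (ℕ; _≥_; _*_)
open import Data.Integer.Base using (+_)
open import Data.Rational.Base using (_/_; _≤_; toℚᵘ)

open import Data.Bool.Base using (true; false; if_then_else_; _∨_)
open import Data.Fin using (Fin; zero; suc; toℕ; #_)
open import Data.Fin.Properties using (all?; any?; _≟_)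
open import Data.Fin.Subset using (Subset; ∣_∣; ⁅_⁆; inside; outside)
open import Data.Fin.Subset.Properties using (x∈⁅x⁆)
import Data.Integer.Base as ℤ
open import Data.Integer.Properties using (pos-*)
open import Data.List.Base as List using (List; []; _∷_; map; length; allFin)
open import Data.List.Membership.DecPropositional using (_∈?_)
open import Data.List.Membership.Propositional using (_∈_; _∉_)
open import Data.List.Membership.Propositional.Properties using (∈-allFin)
open import Data.List.Membership.Propositional.Properties.WithK using (unique∧set⇒bag)
open import Data.List.Properties using (length-tabulate; map-tabulate)
open import Data.List.Relation.Binary.BagAndSetEquality using (∼bag⇒↭)
open import Data.List.Relation.Binary.Permutation.Propositional using (_↭_)
open import Data.List.Relation.Binary.Permutation.Propositional.Properties using (map⁺; ↭-length)
open import Data.List.Relation.Binary.Subset.Propositional using (_⊆_)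
import Data.List.Relation.Unary.All as All
import Data.List.Relation.Unary.AllPairs as AllPairs
open import Data.List.Relation.Unary.All.Properties using (¬Any⇒All¬)
open import Data.List.Relation.Unary.Any using (here; there)
open import Data.List.Relation.Unary.Unique.Propositional using (Unique)
open import Data.List.Relation.Unary.Unique.Propositional.Properties using (allFin⁺)
open import Data.Nat.Base as ℕ using (_+_; _∸_; z≤n; s≤s)
open import Data.Nat.ListAction using () renaming (sum to sumₗ)
open import Data.Nat.ListAction.Properties using (sum-↭)
import Data.Nat.Properties as ℕ
open import Data.Nat.Solver using (module +-*-Solver)
open import Data.Product.Base using (∃; ∃₂; _×_; _,_)
import Data.Rational.Properties as ℚ
open import Data.Rational.Unnormalised.Base using (mkℚᵘ; *≤*)
import Data.Rational.Unnormalised.Properties as ℚᵘ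
open import Data.Sum.Base using (_⊎_; inj₁; inj₂)
open import Data.Vec.Base as Vec using (Vec; []; _∷_; lookup)
open import Data.Vec.Functional using (updateAt)
open import Data.Vec.Functional.Properties using (updateAt-updates; updateAt-minimal)
open import Data.Vec.Properties using (lookup∘tabulate; lookup-zipWith; []=⇒lookup; lookup-replicate)
open import Function.Base using (_∘_; const; id)
open import Function.Bundles using (mk⇔)
open import Relation.Binary.Construct.Closure.ReflexiveTransitive using (Star; ε; _◅_)
open import Relation.Binary.PropositionalEquality
open import Relation.Nullary using (Dec; yes; no; does; contradiction)
open import Relation.Nullary.Decidable using (toWitness; _×-dec_; _⊎-dec_; _→-dec_; dec-true)

open import Algebra.Properties.Monoid.Sum ℕ.+-0-monoid using (sum; sum-cong-≗)
open +-*-Solver using (solve; _:+_; _:=_)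

private
  variable
    p : ℕ
    L : List (Fin p)

-- Sums over lists of vertices

Σ : (Fin p → ℕ) → List (Fin p) → ℕ
Σ f L = sumₗ (map f L)

Σ-mono : ∀ {f g : Fin p → ℕ} L → (∀ {w} → w ∈ L → f w ℕ.≤ g w) → Σ f L ℕ.≤ Σ g L
Σ-mono []      le = z≤n
Σ-mono (w ∷ L) le = ℕ.+-mono-≤ (le (here refl)) (Σ-mono L (le ∘ there))

Σ-+ : ∀ (f g : Fin p → ℕ) L → Σ (λ w → f w + g w) L ≡ Σ f L + Σ g L
Σ-+ f g []      = refl
Σ-+ f g (w ∷ L) = begin
  f w + g w + Σ (λ u → f u + g u) L ≡⟨ cong (λ s → f w + g w + s) (Σ-+ f g L) ⟩
  f w + g w + (Σ f L + Σ g L)       ≡⟨ solve 4 (λ a b c d → a :+ b :+ (c :+ d) := a :+ c :+ (b :+ d)) refl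
                                          (f w) (g w) (Σ f L) (Σ g L) ⟩
  f w + Σ f L + (g w + Σ g L)       ∎
  where open ≡-Reasoning

Σ-*ˡ : ∀ k (f : Fin p → ℕ) L → Σ (λ w → k * f w) L ≡ k * Σ f L
Σ-*ˡ k f []      = sym (ℕ.*-zeroʳ k)
Σ-*ˡ k f (w ∷ L) = trans (cong (λ s → k * f w + s) (Σ-*ˡ k f L)) (sym (ℕ.*-distribˡ-+ k (f w) (Σ f L)))

Σ-1 : ∀ (L : List (Fin p)) → Σ (const 1) L ≡ length L
Σ-1 []      = refl
Σ-1 (_ ∷ L) = cong ℕ.suc (Σ-1 L)

term≤Σ : ∀ (f : Fin p → ℕ) {u} → u ∈ L → f u ℕ.≤ Σ f L
term≤Σ f (here refl)        = ℕ.m≤m+n _ _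
term≤Σ f (there {x = w} u∈) = ℕ.≤-trans (term≤Σ f u∈) (ℕ.m≤n+m _ (f w))

-- Without repetitions `u` occurs once, so the slack at `u` is used exactly once. In a contraction
-- only the entry of `u` changes, and `a` is the term of the removed leaf.
Σ-exchange : ∀ {f g : Fin p → ℕ} {u a b} → Unique L → u ∈ L →
             (∀ {w} → w ∈ L → w ≢ u → f w ℕ.≤ g w) →
             f u + a ℕ.≤ g u + b → Σ f L + a ℕ.≤ Σ g L + b
Σ-exchange {L = u ∷ L} {f} {g} {a = a} {b} (u∉ AllPairs.∷ _) (here refl) le fu = begin
  f u + Σ f L + a   ≡⟨ shuffle (f u) (Σ f L) a ⟩
  f u + a + Σ f L   ≤⟨ ℕ.+-mono-≤ fu (Σ-mono L λ w∈ → le (there w∈) (≢-sym (All.lookup u∉ w∈))) ⟩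
  g u + b + Σ g L   ≡⟨ shuffle (g u) (Σ g L) b ⟨
  g u + Σ g L + b   ∎
  where
  open ℕ.≤-Reasoning
  shuffle : ∀ x y z → x + y + z ≡ x + z + y
  shuffle = solve 3 (λ x y z → x :+ y :+ z := x :+ z :+ y) refl
Σ-exchange {L = w ∷ L} {f} {g} {a = a} {b} (w∉ AllPairs.∷ uniq) (there u∈) le fu = begin
  f w + Σ f L + a    ≡⟨ ℕ.+-assoc (f w) _ _ ⟩
  f w + (Σ f L + a)  ≤⟨ ℕ.+-mono-≤ (le (here refl) (All.lookup w∉ u∈)) (Σ-exchange uniq u∈ (le ∘ there) fu) ⟩
  g w + (Σ g L + b)  ≡⟨ ℕ.+-assoc (g w) _ _ ⟨
  g w + Σ g L + b    ∎
  where open ℕ.≤-Reasoning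

complete⇒↭allFin : Unique L → (∀ v → v ∈ L) → L ↭ allFin p
complete⇒↭allFin uniq complete =
  ∼bag⇒↭ (unique∧set⇒bag uniq (allFin⁺ _) (mk⇔ (λ _ → ∈-allFin _) (λ _ → complete _)))

sum≡sumₗ-tabulate : ∀ (f : Fin p → ℕ) → sum f ≡ sumₗ (List.tabulate f)
sum≡sumₗ-tabulate {ℕ.zero}  f = refl
sum≡sumₗ-tabulate {ℕ.suc p} f = cong (λ s → f zero + s) (sum≡sumₗ-tabulate (f ∘ suc))

-- Moves the sums of the definitions to the order of growth, where induction on the tree is
-- possible.
sum≡Σ : ∀ {L : List (Fin p)} → Unique L → (∀ v → v ∈ L) → ∀ f → sum f ≡ Σ f L
sum≡Σ {p} {L} uniq complete f = begin
  sum f                    ≡⟨ sum≡sumₗ-tabulate f ⟩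
  sumₗ (List.tabulate f)   ≡⟨ cong sumₗ (map-tabulate id f) ⟨
  Σ f (allFin p)           ≡⟨ sum-↭ (map⁺ f (complete⇒↭allFin uniq complete)) ⟨
  Σ f L                    ∎
  where open ≡-Reasoning

-- States and cost profiles

State : Set
State = Fin 5

-- State 2 is a satisfied root that promises nothing. A lone vertex pays label 3 for it; in a larger
-- tree it may stand for a lower label whose need the children have met.
label : State → Fin 5
label = lookup (# 4 ∷ # 3 ∷ # 3 ∷ # 2 ∷ # 0 ∷ [])

-- What a vertex in the given state offers each neighbour, and what it still
-- requires from its neighbours in total.
gain need : State → ℕ
gain = lookup (3 ∷ 2 ∷ 0 ∷ 0 ∷ 0 ∷ [])
need = lookup (0 ∷ 0 ∷ 0 ∷ 1 ∷ 3 ∷ [])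

gain≤label∸1 : ∀ x → gain x ℕ.≤ toℕ (label x) ∸ 1
gain≤label∸1 = toWitness {a? = all? λ x → gain x ℕ.≤? toℕ (label x) ∸ 1} _

3≤label+need : ∀ x → 3 ℕ.≤ toℕ (label x) + need x
3≤label+need = toWitness {a? = all? λ x → 3 ℕ.≤? toℕ (label x) + need x} _

Profile : Set
Profile = Fin 5

single : Profile
single = # 0

-- Upper bounds, for a rooted tree with m vertices, on
-- 4 · (least weight leaving the root in state x) ∸ 7 · (m ∸ 1).
-- The rows are the single vertex, the single edge, and three rows that cover
-- all larger trees, found by closing the first row under joins.
cost : Profile → State → ℕ
cost t = lookup (lookup table t)
  where
  table : Vec (Vec ℕ 5) 5
  table = (16 ∷ 12 ∷ 12 ∷ 8 ∷ 0 ∷ [])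
        ∷ ( 9 ∷  9 ∷  9 ∷ 5 ∷ 5 ∷ [])
        ∷ (12 ∷  9 ∷  7 ∷ 7 ∷ 7 ∷ [])
        ∷ (14 ∷ 10 ∷  2 ∷ 2 ∷ 2 ∷ [])
        ∷ (16 ∷ 12 ∷  5 ∷ 2 ∷ 0 ∷ [])
        ∷ []

-- Number of vertices, capped at 3.
size : Profile → ℕ
size = lookup (1 ∷ 2 ∷ 3 ∷ 3 ∷ 3 ∷ [])

cost-single : ∀ x → cost single x ≡ 4 * toℕ (label x)
cost-single = toWitness {a? = all? λ x → cost single x ℕ.≟ 4 * toℕ (label x)} _

-- A root in state x with a new child in state y behaves as a root in state z.
Compatible : State → State → State → Set
Compatible x y z = gain z ℕ.≤ gain x × need y ℕ.≤ gain x × need x ℕ.≤ gain y + need z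

-- Each cost leaves one vertex of its tree uncharged. Two trees leave two, their join only one,
-- hence the 7. The size clause preserves a total size of at least 3.
Joins : Profile → Profile → Profile → Set
Joins s t r = (3 ℕ.≤ size r ⊎ size s + size t ℕ.≤ size r) ×
  (∀ z → ∃₂ λ x y → Compatible x y z × cost s x + cost t y ℕ.≤ cost r z + 7)

-- Abstract, so that the finite checks are not unfolded again at their uses.
abstract
  join : ∀ s t → ∃ (Joins s t)
  join = toWitness {a? = all? λ s → all? λ t → any? (joins? s t)} _
    where
    joins? : ∀ s t r → Dec (Joins s t r)
    joins? s t r = (3 ℕ.≤? size r ⊎-dec size s + size t ℕ.≤? size r) ×-dec
      all? λ z → any? λ x → any? λ y →
        (gain z ℕ.≤? gain x ×-dec need y ℕ.≤? gain x ×-dec need x ℕ.≤? gain y + need z)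
        ×-dec cost s x + cost t y ℕ.≤? cost r z + 7

  -- Nothing outside the whole tree can serve its root, hence need 0; the 7 charges the vertex
  -- omitted from 7 · (m ∸ 1).
  close-root : ∀ t → 3 ℕ.≤ size t → ∃ λ x → need x ≡ 0 × cost t x ℕ.≤ 7
  close-root = toWitness {a? = all? λ t → 3 ℕ.≤? size t →-dec
    any? λ x → need x ℕ.≟ 0 ×-dec cost t x ℕ.≤? 7} _

-- Spanning trees and the contraction of leaves

module _ (Γ : Graph p) where
  open Graph Γ

  -- The head is the newest vertex, hence a leaf of the grown tree, so structural recursion removes
  -- leaves.
  data Grown : List (Fin p) → Set where
    root   : ∀ r → Grown (r ∷ [])
    attach : ∀ {u v L} → Grown L → u ∈ L → v ∉ L → u ~ v → Grown (v ∷ L)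

  grown-unique : Grown L → Unique L
  grown-unique (root r)            = All.[] AllPairs.∷ AllPairs.[]
  grown-unique (attach g _ v∉ _)   = ¬Any⇒All¬ _ v∉ AllPairs.∷ grown-unique g

  grow-along : ∀ {u v} → Star _~_ u v → Grown L → u ∈ L → ∃ λ L′ → Grown L′ × L ⊆ L′ × v ∈ L′
  grow-along ε g u∈ = _ , g , id , u∈
  grow-along {L = L} (_◅_ {j = w} u~w path) g u∈ with _∈?_ _≟_ w L
  ... | yes w∈ = grow-along path g w∈
  ... | no w∉ with L′ , g′ , ⊆L′ , v∈ ← grow-along path (attach g u∈ w∉ u~w) (here refl) =
    L′ , g′ , ⊆L′ ∘ there , v∈

  grow-over : Connected Γ → Fin p → ∀ vs → ∃ λ L → Grown L × vs ⊆ L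
  grow-over conn r []       = _ , root r , λ ()
  grow-over conn r (v ∷ vs) with grow-over conn r vs
  -- Grown lists are nonempty; the head serves as the start of a path to `v`.
  ... | w ∷ L , g , vs⊆ with L′ , g′ , ⊆L′ , v∈ ← grow-along (conn w v) g (here refl) =
    L′ , g′ , λ { (here refl) → v∈ ; (there u∈) → ⊆L′ (vs⊆ u∈) }

  -- All neighbours in `Γ` count, not only those along grown edges; further terms can only enlarge
  -- the sums.
  nbr : Fin p → (Fin p → ℕ) → Fin p → ℕ
  nbr v f w = if does (v ~? w) then f w else 0

  nbr-mono : ∀ v (f g : Fin p → ℕ) w → f w ℕ.≤ g w → nbr v f w ℕ.≤ nbr v g w
  nbr-mono v f g w le with does (v ~? w)
  ... | true  = le
  ... | false = z≤n

  nbr-adjacent : ∀ {v w} f → v ~ w → nbr v f w ≡ f w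
  nbr-adjacent {v} {w} f v~w = cong (if_then f w else 0) (dec-true (v ~? w) v~w)

  Served : List (Fin p) → (Fin p → State) → Set
  Served L x = ∀ {v} → v ∈ L → need (x v) ℕ.≤ Σ (nbr v (gain ∘ x)) L

  totalCost : (Fin p → Profile) → (Fin p → State) → List (Fin p) → ℕ
  totalCost t x = Σ (λ v → cost (t v) (x v))

  -- Passing from `x′` back to `x` lowers no gain on `L`, so the other vertices stay served. The
  -- vertex `v` is served by `u` alone, and `v` covers the part of the need of `u` that `x′` does
  -- not record.
  served-attach : ∀ {u v L} x x′ → u ∈ L → u ~ v →
    (∀ {w} → w ∈ L → w ≢ u → x w ≡ x′ w) → Compatible (x u) (x v) (x′ u) →
    Served L x′ → Served (v ∷ L) x
  served-attach {u} {v} {L} x x′ u∈ u~v agree (gain≤ , need-v , need-u) served = go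
    where
    open ℕ.≤-Reasoning
    gain-mono : ∀ {w} → w ∈ L → gain (x′ w) ℕ.≤ gain (x w)
    gain-mono {w} w∈ with w ≟ u
    ... | yes refl = gain≤
    ... | no w≢u   = ℕ.≤-reflexive (cong gain (sym (agree w∈ w≢u)))

    Σ-gain-mono : ∀ w → Σ (nbr w (gain ∘ x′)) L ℕ.≤ Σ (nbr w (gain ∘ x)) L
    Σ-gain-mono w = Σ-mono L λ {w′} w′∈ → nbr-mono w (gain ∘ x′) (gain ∘ x) w′ (gain-mono w′∈)

    go : Served (v ∷ L) x
    go (here refl) = begin
      need (x v)                     ≤⟨ need-v ⟩
      gain (x u)                     ≡⟨ nbr-adjacent (gain ∘ x) (~-sym u~v) ⟨
      nbr v (gain ∘ x) u             ≤⟨ term≤Σ (nbr v (gain ∘ x)) (there u∈) ⟩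
      Σ (nbr v (gain ∘ x)) (v ∷ L)   ∎
    go {w} (there w∈) with w ≟ u
    go (there w∈) | yes refl = begin
      need (x u)                                ≤⟨ need-u ⟩
      gain (x v) + need (x′ u)                  ≤⟨ ℕ.+-monoʳ-≤ (gain (x v)) (served u∈) ⟩
      gain (x v) + Σ (nbr u (gain ∘ x′)) L      ≤⟨ ℕ.+-monoʳ-≤ (gain (x v)) (Σ-gain-mono u) ⟩
      gain (x v) + Σ (nbr u (gain ∘ x)) L       ≡⟨ cong (_+ Σ (nbr u (gain ∘ x)) L) (nbr-adjacent (gain ∘ x) u~v) ⟨
      Σ (nbr u (gain ∘ x)) (v ∷ L)              ∎
    go {w} (there w∈) | no w≢u = begin
      need (x w)                                ≡⟨ cong need (agree w∈ w≢u) ⟩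
      need (x′ w)                               ≤⟨ served w∈ ⟩
      Σ (nbr w (gain ∘ x′)) L                   ≤⟨ Σ-gain-mono w ⟩
      Σ (nbr w (gain ∘ x)) L                    ≤⟨ ℕ.m≤n+m _ (nbr w (gain ∘ x) v) ⟩
      Σ (nbr w (gain ∘ x)) (v ∷ L)              ∎

  -- The leaf v added last is contracted into its neighbour u by joining their profiles.
  assign-states : Grown L → ∀ t → 3 ℕ.≤ Σ (size ∘ t) L →
    ∃ λ x → Served L x × totalCost t x L ℕ.≤ 7 * length L
  assign-states (root r) t 3≤
    with y , need-y , cost-y ← close-root (t r) (subst (3 ℕ.≤_) (ℕ.+-identityʳ _) 3≤) =
    const y , (λ _ → ℕ.≤-trans (ℕ.≤-reflexive need-y) z≤n) ,
    subst (ℕ._≤ 7) (sym (ℕ.+-identityʳ _)) cost-y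
  assign-states (attach {u} {v} {L} g u∈ v∉ u~v) t 3≤
    -- The profile `r` is fixed before the recursion; `split` later resolves the state returned for
    -- `u` into states of `u` and `v`.
    with r , size-r , split ← join (t u) (t v) = conclude (assign-states g t′ (3≤′ size-r))
    where
    open ℕ.≤-Reasoning
    t′ : Fin p → Profile
    t′ = updateAt t u (const r)

    t′u : t′ u ≡ r
    t′u = updateAt-updates u t

    t′w : ∀ {w} → w ≢ u → t′ w ≡ t w
    t′w w≢u = updateAt-minimal _ u t w≢u

    3≤′ : 3 ℕ.≤ size r ⊎ size (t u) + size (t v) ℕ.≤ size r → 3 ℕ.≤ Σ (size ∘ t′) L
    3≤′ (inj₁ 3≤r) = begin
      3                  ≤⟨ 3≤r ⟩
      size r             ≡⟨ cong size t′u ⟨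
      size (t′ u)        ≤⟨ term≤Σ (size ∘ t′) u∈ ⟩
      Σ (size ∘ t′) L    ∎
    3≤′ (inj₂ add) = begin
      3                                ≤⟨ 3≤ ⟩
      size (t v) + Σ (size ∘ t) L      ≡⟨ ℕ.+-comm (size (t v)) _ ⟩
      Σ (size ∘ t) L + size (t v)      ≤⟨ Σ-exchange (grown-unique g) u∈
        (λ _ w≢u → ℕ.≤-reflexive (cong size (sym (t′w w≢u))))
        (ℕ.≤-trans add (ℕ.≤-reflexive (trans (cong size (sym t′u)) (sym (ℕ.+-identityʳ _))))) ⟩
      Σ (size ∘ t′) L + 0              ≡⟨ ℕ.+-identityʳ _ ⟩
      Σ (size ∘ t′) L                  ∎

    conclude : (∃ λ x′ → Served L x′ × totalCost t′ x′ L ℕ.≤ 7 * length L) →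
               ∃ λ x → Served (v ∷ L) x × totalCost t x (v ∷ L) ℕ.≤ 7 * length (v ∷ L)
    conclude (x′ , served , bound) with a , b , compat , cost≤ ← split (x′ u) =
      x , served-attach x x′ u∈ u~v xw
            (subst₂ (λ a b → Compatible a b (x′ u)) (sym xu) (sym xv) compat) served ,
      (begin
        cost (t v) (x v) + totalCost t x L   ≡⟨ ℕ.+-comm (cost (t v) (x v)) _ ⟩
        -- The term of `v` is absorbed at `u` for 7, the share of one vertex in the bound.
        totalCost t x L + cost (t v) (x v)   ≤⟨ Σ-exchange (grown-unique g) u∈
          (λ w∈ w≢u → ℕ.≤-reflexive (cong₂ cost (sym (t′w w≢u)) (xw w∈ w≢u)))
          (subst₂ ℕ._≤_ (sym (cong₂ (λ a b → cost (t u) a + cost (t v) b) xu xv))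
            (cong (λ s → cost s (x′ u) + 7) (sym t′u)) cost≤) ⟩
        totalCost t′ x′ L + 7                ≤⟨ ℕ.+-monoˡ-≤ 7 bound ⟩
        7 * length L + 7                     ≡⟨ ℕ.+-comm (7 * length L) 7 ⟩
        7 + 7 * length L                     ≡⟨ ℕ.*-suc 7 (length L) ⟨
        7 * ℕ.suc (length L)                 ∎)
      where
      x : Fin p → State
      x = updateAt (updateAt x′ u (const a)) v (const b)

      ≢v : ∀ {w} → w ∈ L → w ≢ v
      ≢v w∈ refl = v∉ w∈

      xv : x v ≡ b
      xv = updateAt-updates v (updateAt x′ u (const a))

      xu : x u ≡ a
      xu = trans (updateAt-minimal u v _ (≢v u∈)) (updateAt-updates u x′)

      xw : ∀ {w} → w ∈ L → w ≢ u → x w ≡ x′ w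
      xw w∈ w≢u = trans (updateAt-minimal _ v _ (≢v w∈)) (updateAt-minimal _ u x′ w≢u)

-- Triple Roman domination

∣∣≡sum : ∀ (S : Subset p) → ∣ S ∣ ≡ sum (λ u → if lookup S u then 1 else 0)
∣∣≡sum []            = refl
∣∣≡sum (inside  ∷ S) = cong ℕ.suc (∣∣≡sum S)
∣∣≡sum (outside ∷ S) = ∣∣≡sum S

excess : Labelling p → Fin p → ℕ
excess h u = toℕ (h u) ∸ 1

weight≡sum : ∀ (h : Labelling p) → weight h ≡ sum (toℕ ∘ h)
weight≡sum h = sum-cong-≗ λ u → cong (if_then toℕ (h u) else 0) (lookup-replicate u inside)

module _ (Γ : Graph p) where
  open Graph Γ

  indicatorAN : Labelling p → Fin p → Fin p → ℕ
  indicatorAN h v w = if lookup (AN Γ h v) w then 1 else 0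

  valueAN[] : Labelling p → Fin p → Fin p → ℕ
  valueAN[] h v w = if lookup (AN[_,_] Γ h v) w then toℕ (h w) else 0

  -- A positive label is 1 plus its excess; for label 0 both terms vanish because the subtraction is
  -- truncated.
  indicatorAN+excess≡ : ∀ h v w →
    indicatorAN h v w + nbr Γ v (excess h) w ≡ nbr Γ v (toℕ ∘ h) w
  indicatorAN+excess≡ h v w
    rewrite lookup∘tabulate (λ w → does ((v ~? w) ×-dec (toℕ (h w) ℕ.≥? 1))) w
    with v ~? w | h w
  ... | no _  | _     = refl
  ... | yes _ | zero  = refl
  ... | yes _ | suc _ = refl

  nbr-self : ∀ v f → nbr Γ v f v ≡ 0
  nbr-self v f with v ~? v
  ... | yes v~v = contradiction v~v (~-irrefl v)
  ... | no _    = refl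

  valueAN[]-self : ∀ h v → valueAN[] h v v ≡ toℕ (h v)
  valueAN[]-self h v
    rewrite lookup-zipWith _∨_ v (AN Γ h v) ⁅ v ⁆ | []=⇒lookup (x∈⁅x⁆ v)
    with lookup (AN Γ h v) v
  ... | true  = refl
  ... | false = refl

  valueAN[]-other : ∀ h v {w} → w ≢ v → nbr Γ v (toℕ ∘ h) w ℕ.≤ valueAN[] h v w
  valueAN[]-other h v {w} w≢v
    rewrite lookup-zipWith _∨_ w (AN Γ h v) ⁅ v ⁆
          | lookup∘tabulate (λ w → does ((v ~? w) ×-dec (toℕ (h w) ℕ.≥? 1))) w
    with v ~? w | h w
  ... | no _  | _     = z≤n
  ... | yes _ | zero  = z≤n
  ... | yes _ | suc _ = ℕ.≤-refl

  excess⇒Is3RDF : ∀ {L} → Unique L → (∀ v → v ∈ L) → ∀ h →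
    (∀ v → 3 ℕ.≤ toℕ (h v) + Σ (nbr Γ v (excess h)) L) → Is3RDF Γ h
  excess⇒Is3RDF {L} uniq complete h enough v _ = begin
    ∣ AN Γ h v ∣ + 3                                 ≡⟨ cong (_+ 3) (trans (∣∣≡sum (AN Γ h v)) (sum≡Σ uniq complete _)) ⟩
    Σ (indicatorAN h v) L + 3                        ≤⟨ ℕ.+-monoʳ-≤ _ (enough v) ⟩
    Σ (indicatorAN h v) L + (toℕ (h v) + Σ exc L)    ≡⟨ solve 3 (λ a b c → a :+ (b :+ c) := a :+ c :+ b) refl
      (Σ (indicatorAN h v) L) (toℕ (h v)) (Σ exc L) ⟩
    Σ (indicatorAN h v) L + Σ exc L + toℕ (h v)      ≡⟨ cong (_+ toℕ (h v)) (Σ-+ (indicatorAN h v) exc L) ⟨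
    -- The graph has no loops, so the entry at `v` is empty and takes in the separate summand `h v`.
    Σ (λ w → indicatorAN h v w + exc w) L + toℕ (h v) ≤⟨ Σ-exchange uniq (complete v)
      (λ {w} _ w≢v → ℕ.≤-trans (ℕ.≤-reflexive (indicatorAN+excess≡ h v w)) (valueAN[]-other h v w≢v))
      (ℕ.≤-reflexive at-v) ⟩
    Σ (valueAN[] h v) L + 0                          ≡⟨ ℕ.+-identityʳ _ ⟩
    Σ (valueAN[] h v) L                              ≡⟨ sum≡Σ uniq complete (valueAN[] h v) ⟨
    h ⟦ AN[_,_] Γ h v ⟧                              ∎
    where
    open ℕ.≤-Reasoning
    exc : Fin p → ℕ
    exc = nbr Γ v (excess h)

    at-v : indicatorAN h v v + exc v + toℕ (h v) ≡ valueAN[] h v v + 0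
    at-v = trans (cong (_+ toℕ (h v)) (trans (indicatorAN+excess≡ h v v) (nbr-self v (toℕ ∘ h))))
      (trans (sym (valueAN[]-self h v)) (sym (ℕ.+-identityʳ _)))

  light-3RDF : 3 ℕ.≤ p → Connected Γ → ∃ λ h → Is3RDF Γ h × 4 * weight h ℕ.≤ 7 * p
  -- The match exposes `p` as a successor, so `zero` exists as a root.
  light-3RDF 3≤p@(s≤s _) conn
    with L , g , all⊆L ← grow-over Γ conn zero (allFin p) =
    -- Before any contraction every vertex is a tree of its own, of size 1.
    conclude (assign-states Γ g (const single) 3≤size)
    where
    open ℕ.≤-Reasoning
    uniq : Unique L
    uniq = grown-unique Γ g

    complete : ∀ v → v ∈ L
    complete v = all⊆L (∈-allFin v)

    length-L : length L ≡ p
    length-L = trans (↭-length (complete⇒↭allFin uniq complete)) (length-tabulate id)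

    3≤size : 3 ℕ.≤ Σ (const 1) L
    3≤size = subst (3 ℕ.≤_) (sym (trans (Σ-1 L) length-L)) 3≤p

    conclude : (∃ λ x → Served Γ L x × totalCost Γ (const single) x L ℕ.≤ 7 * length L) →
               ∃ λ h → Is3RDF Γ h × 4 * weight h ℕ.≤ 7 * p
    conclude (x , served , bound) = h , excess⇒Is3RDF uniq complete h enough , (begin
      4 * weight h                       ≡⟨ cong (4 *_) (trans (weight≡sum h) (sum≡Σ uniq complete _)) ⟩
      4 * Σ (toℕ ∘ h) L                  ≡⟨ Σ-*ˡ 4 (toℕ ∘ h) L ⟨
      Σ (λ v → 4 * toℕ (h v)) L          ≤⟨ Σ-mono L (λ {v} _ → ℕ.≤-reflexive (sym (cost-single (x v)))) ⟩
      totalCost Γ (const single) x L     ≤⟨ bound ⟩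
      7 * length L                       ≡⟨ cong (7 *_) length-L ⟩
      7 * p                              ∎)
      where
      h : Labelling p
      h = label ∘ x

      enough : ∀ v → 3 ℕ.≤ toℕ (h v) + Σ (nbr Γ v (excess h)) L
      enough v = begin
        3                                                   ≤⟨ 3≤label+need (x v) ⟩
        toℕ (h v) + need (x v)                              ≤⟨ ℕ.+-monoʳ-≤ _ (served (complete v)) ⟩
        toℕ (h v) + Σ (nbr Γ v (gain ∘ x)) L                ≤⟨ ℕ.+-monoʳ-≤ _
          (Σ-mono L λ {w} _ → nbr-mono Γ v (gain ∘ x) (excess h) w (gain≤label∸1 (x w))) ⟩
        toℕ (h v) + Σ (nbr Γ v (excess h)) L     ∎

-- The bound in rational numbers

/-≤ : ∀ m n → 4 * m ℕ.≤ n → + m / 1 ≤ + n / 4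
/-≤ m n 4m≤n = ℚ.toℚᵘ-cancel-≤ (begin
  -- `_/_` normalises, so the fractions are compared unnormalised; `mkℚᵘ` takes the denominator
  -- minus one.
  toℚᵘ (+ m / 1)   ≃⟨ ℚ.toℚᵘ-fromℚᵘ (mkℚᵘ (+ m) 0) ⟩
  mkℚᵘ (+ m) 0       ≤⟨ *≤* cross ⟩
  mkℚᵘ (+ n) 3       ≃⟨ ℚ.toℚᵘ-fromℚᵘ (mkℚᵘ (+ n) 3) ⟨
  toℚᵘ (+ n / 4)   ∎)
  where
  open ℚᵘ.≤-Reasoning
  cross : + m ℤ.* + 4 ℤ.≤ + n ℤ.* + 1
  cross = subst₂ ℤ._≤_ (pos-* m 4) (pos-* n 1)
    (ℤ.+≤+ (subst₂ ℕ._≤_ (ℕ.*-comm 4 m) (sym (ℕ.*-identityʳ n)) 4m≤n))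

theorem13 : ∀ (p : ℕ) → p ≥ 3 → (T : Graph p) → IsTree T →
    + (γ[3R] T) / 1 ≤ + (7 * p) / 4
theorem13 p 3≤p T tree = /-≤ (γ[3R] T) (7 * p) (bound (light-3RDF T 3≤p (IsTree.connected tree)))
  where
  bound : (∃ λ h → Is3RDF T h × 4 * weight h ℕ.≤ 7 * p) → 4 * γ[3R] T ℕ.≤ 7 * p
  bound (h , dom , light) =
    ℕ.≤-trans (ℕ.*-monoʳ-≤ 4 (IsMin3RDFWeight.lowerBound (γ[3R]-isMin T) h dom)) light
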